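{- Let $p=(p_1,\dots,p_n)$ be a sequence of positive integers, let $k=\min_i p_i$, and let $A,B\subseteq S_p$ be a cross-intersecting pair of families. Then $|A|\cdot|B|\le |S_p|^2/k^2$. Equality holds for $A=B=\{x\in S_p : x_i=j\}$ whenever $i\in[n]$ satisfies $p_i=k$ and $j\in[k]$. If $k\neq 2$, these are the only cross-intersecting pairs $(A,B)$ attaining equality.
   Context: For a positive integer $m$, $[m]=\{1,\dots,m\}$. For a sequence of positive integers $p=(p_1,\dots,p_n)$, $S_p=[p_1]\times\cdots\times[p_n]$; its elements are called vectors. Two vectors $x,y\in S_p$ are $r$-intersecting if $|\{i\in[n]: x_i=y_i\}|\ge r$. Two families $A,B\subseteq S_p$ are $r$-cross-intersecting if every $x\in A$ and $y\in B$ are $r$-intersecting; "cross-intersecting" means $1$-cross-intersecting. -}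

module Defs where

open import Data.Bool.Base using (Bool; true; T)
open import Data.Bool.Properties using (T?)
open import Data.Fin.Base using (Fin; zero; suc)
open import Data.Fin.Properties using (_≟_)
open import Data.Fin.Subset using (Subset; ∣_∣)
open import Data.List.Base using (List; []; _∷_; allFin; cartesianProductWith; filter; length)
open import Data.List.Membership.Propositional using (_∈_)
open import Data.List.Membership.Propositional.Properties using (∈-allFin; ∈-cartesianProductWith⁺)
open import Data.List.Relation.Unary.All using ([])
open import Data.List.Relation.Unary.AllPairs using ([]; _∷_)
open import Data.List.Relation.Unary.Any using (here)
open import Data.List.Relation.Unary.Unique.Propositional using (Unique)
open import Data.List.Relation.Unary.Unique.Propositional.Properties using (allFin⁺; cartesianProductWith⁺)
open import Data.Nat.Base using (ℕ; suc; _≤_; _⊓_)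
open import Data.Product.Base using (_,_)
open import Data.Vec.Base using (Vec; []; _∷_; lookup; tabulate; foldr₁)
open import Data.Vec.Relation.Unary.All using (All; []; _∷_)
open import Relation.Binary.PropositionalEquality.Core using (_≡_; refl)
open import Relation.Nullary.Decidable.Core using (does)

private
  variable
    n : ℕ
    p : Vec ℕ n

-- S p is the product of the Fin pᵢ. Using All rather than dependent functions
-- makes propositional equality of vectors coordinatewise.
S : Vec ℕ n → Set
S p = All Fin p

infix 9 _at_

_at_ : S p → (i : Fin n) → Fin (lookup p i)
(a ∷ x) at zero  = a
(a ∷ x) at suc i = x at i

agreement : {p : Vec ℕ n} → S p → S p → Subset n
agreement x y = tabulate λ i → does (x at i ≟ y at i)

Intersecting : ℕ → S p → S p → Set
Intersecting r x y = r ≤ ∣ agreement x y ∣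

Family : Vec ℕ n → Set
Family p = S p → Bool

CrossIntersecting : ℕ → Family p → Family p → Set
CrossIntersecting r A B = ∀ x y → T (A x) → T (B y) → Intersecting r x y

vectors : (p : Vec ℕ n) → List (S p)
vectors []      = [] ∷ []
vectors (m ∷ p) = cartesianProductWith _∷_ (allFin m) (vectors p)

vectors-complete : (x : S p) → x ∈ vectors p
vectors-complete []      = here refl
vectors-complete (a ∷ x) = ∈-cartesianProductWith⁺ _∷_ (∈-allFin a) (vectors-complete x)

vectors-unique : (p : Vec ℕ n) → Unique (vectors p)
vectors-unique []      = [] ∷ []
vectors-unique (m ∷ p) =
  cartesianProductWith⁺ _∷_ (λ { refl → refl , refl }) (allFin⁺ m) (vectors-unique p)

card : Family p → ℕ
card {p = p} A = length (filter (λ x → T? (A x)) (vectors p))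

full : (p : Vec ℕ n) → Family p
full p _ = true

star : (p : Vec ℕ n) (i : Fin n) → Fin (lookup p i) → Family p
star p i j x = does (x at i ≟ j)

minimum : Vec ℕ (suc n) → ℕ
minimum = foldr₁ _⊓_

{-# OPTIONS --safe #-}
module Submission where

-- With densities a, b and k ≥ 2, every cross-intersecting pair satisfies the odds inequality
-- (k - 1)² a b ≤ (1 - a)(1 - b), which implies a b ≤ 1/k². Unlike the latter, it is inductive:
-- the slices A_i and B_j along the first coordinate are cross-intersecting for i ≠ j. Writing
-- w = (k - 1)² - 1, α = 1 + w a and β = 1 + w b, it reads α_i β_j ≤ (k - 1)² for i ≠ j. If X ≥ Y
-- are the two largest α's and q + 1 is the number of slices, then Σα ≤ X + q Y and
-- Σβ ≤ (k - 1)² (1/Y + q/X), and (X + q Y)² ≤ (q + 1)² X Y because X ≤ (k - 1)² ≤ q² Y.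
-- Equality forces X = Y, so that all slices are again extremal, or X = q² Y, so that
-- A and B fill a single slice.

open import Defs
open import Algebra.Properties.Semiring.Sum as SemiringSum using ()
open import Data.Bool.Base using (Bool; true; false; T)
open import Data.Bool.Properties using (T?)
open import Data.Fin.Base using (Fin; zero; suc; punchIn; punchOut)
open import Data.Fin.Properties using (_≟_; punchInᵢ≢i; punchIn-punchOut)
open import Data.Fin.Subset using (∣_∣)
open import Data.List.Base as List using ([]; _∷_; cartesianProductWith; filter; length; map; tabulate)
open import Data.List.Membership.Propositional using (lose)
open import Data.List.Properties using 
  (filter-++; length-++; filter-some; filter-notAll; filter-all; filter-none; length-filter)
import Data.List.Relation.Unary.All as ListAll
open import Data.Nat.Base
open import Data.Nat.Properties hiding (_≟_)
open import Data.Nat.Tactic.RingSolver using (solve-∀)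
open import Data.Product.Base using (_×_; _,_; Σ-syntax; proj₁; proj₂; swap)
open import Data.Sum.Base using (inj₁; inj₂; [_,_]′; reduce)
open import Data.Unit.Base using (tt)
open import Data.Vec.Base as Vec using (Vec; []; _∷_; lookup)
open import Data.Vec.Membership.Propositional.Properties using (∈-lookup)
open import Data.Vec.Relation.Unary.All as All using (All; []; _∷_)
open import Function.Base using (_∘_; id)
open import Relation.Binary.PropositionalEquality using
  (_≡_; _≢_; _≗_; refl; sym; trans; cong; cong₂; subst; subst₂; module ≡-Reasoning)
open import Relation.Nullary.Decidable using (dec-true; dec-false)
open import Relation.Nullary.Decidable.Core using (does; yes; no)
open import Relation.Nullary.Negation.Core using (contradiction)

open SemiringSum +-*-semiring using (sum; sum-remove; sum-cong-≗; *-distribˡ-sum; sum-replicate-zero)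

-- Finite sums and maxima.

sum-≤ : ∀ {n} {f : Fin n → ℕ} {c} → (∀ i → f i ≤ c) → sum f ≤ n * c
sum-≤ {zero}  f≤c = z≤n
sum-≤ {suc n} f≤c = +-mono-≤ (f≤c zero) (sum-≤ (f≤c ∘ suc))

sum-≤-tight : ∀ {n} {f : Fin n → ℕ} {c} → (∀ i → f i ≤ c) → sum f ≡ n * c → ∀ i → f i ≡ c
sum-≤-tight {suc n} {f} {c} f≤c Σ≡ i = ≤-antisym (f≤c i) (+-cancelʳ-≤ (n * c) c (f i) (begin
  c + n * c                  ≡⟨ Σ≡ ⟨
  sum f                      ≡⟨ sum-remove f ⟩
  f i + sum (f ∘ punchIn i)  ≤⟨ +-monoʳ-≤ (f i) (sum-≤ (f≤c ∘ punchIn i)) ⟩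
  f i + n * c                ∎))
  where open ≤-Reasoning

sum-const : ∀ n c → sum {n} (λ _ → c) ≡ n * c
sum-const zero    c = refl
sum-const (suc n) c = cong (c +_) (sum-const n c)

sum-affine : ∀ {n} (f : Fin n → ℕ) N w → sum (λ i → N + w * f i) ≡ n * N + w * sum f
sum-affine {zero}  f N w = sym (*-zeroʳ w)
sum-affine {suc n} f N w =
  trans (cong (N + w * f zero +_) (sum-affine (f ∘ suc) N w)) (rearr N w (f zero) n (sum (f ∘ suc)))
  where
  rearr : ∀ N w a n s → N + w * a + (n * N + w * s) ≡ N + n * N + w * (a + s)
  rearr = solve-∀

sum-concentrated : ∀ {n} (f : Fin (suc n) → ℕ) i → (∀ j → j ≢ i → f j ≡ 0) → sum f ≡ f i
sum-concentrated {n} f i f≡0 = begin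
  sum f                      ≡⟨ sum-remove f ⟩
  f i + sum (f ∘ punchIn i)  ≡⟨ cong (f i +_) (sum-cong-≗ λ j → f≡0 _ (punchInᵢ≢i i j)) ⟩
  f i + sum {n} (λ _ → 0)    ≡⟨ cong (f i +_) (sum-replicate-zero n) ⟩
  f i + 0                    ≡⟨ +-identityʳ _ ⟩
  f i                        ∎
  where open ≡-Reasoning

argmax : ∀ {n} (f : Fin (suc n) → ℕ) → Σ[ i ∈ Fin (suc n) ] ∀ j → f j ≤ f i
argmax {zero}  f = zero , λ { zero → ≤-refl }
argmax {suc n} f with argmax (f ∘ suc)
... | i , max with ≤-total (f zero) (f (suc i))
... | inj₁ f₀≤ = suc i , λ { zero → f₀≤ ; (suc j) → max j }
... | inj₂ ≤f₀ = zero , λ { zero → ≤-refl ; (suc j) → ≤-trans (max j) ≤f₀ }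

punchIn-≢ : ∀ {n} {P : Fin (suc n) → Set} (i : Fin (suc n)) →
  (∀ j → P (punchIn i j)) → ∀ j → j ≢ i → P j
punchIn-≢ {P = P} i f j j≢i = subst P (punchIn-punchOut (j≢i ∘ sym)) (f (punchOut (j≢i ∘ sym)))

-- The odds inequality for sizes.

-- For k = 2 + t, weight t = (k - 1)² - 1 makes Bounded (weight t) N a b the inequality
-- (k - 1)² a b ≤ (N - a)(N - b), without truncated subtraction.
weight : ℕ → ℕ
weight t = t * (2 + t)

suc-weight : ∀ t → suc (weight t) ≡ suc t * suc t
suc-weight = expand
  where
  expand : ∀ t → suc (t * (2 + t)) ≡ suc t * suc t
  expand = solve-∀

Bounded : (w N a b : ℕ) → Set
Bounded w N a b = w * (a * b) + N * (a + b) ≤ N * N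

-- Multiplied by w and completed by `N * N`, the left side of `Bounded` splits into a factor in a
-- and a factor in b, so that slices can be summed separately.
factor-eq : ∀ w N a b → (N + w * a) * (N + w * b) ≡ N * N + w * (w * (a * b) + N * (a + b))
factor-eq = solve-∀

factor : ∀ {w N a b} → Bounded w N a b → (N + w * a) * (N + w * b) ≤ suc w * (N * N)
factor {w} {N} {a} {b} bd = ≤-trans (≤-reflexive (factor-eq w N a b)) (+-monoʳ-≤ (N * N) (*-monoʳ-≤ w bd))

unfactor : ∀ {w N a b} .{{_ : NonZero w}} → (N + w * a) * (N + w * b) ≤ suc w * (N * N) → Bounded w N a b
unfactor {w} {N} {a} {b} bd = *-cancelˡ-≤ w (+-cancelˡ-≤ (N * N) _ _
  (≤-trans (≤-reflexive (sym (factor-eq w N a b))) bd))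

-- Sums of two sequences with bounded cross products.

-- With d = x - y and e = q² y - x, this is (q + 1)² x y - (x + q y)² = (x - y)(q² y - x).
deficit : ∀ q {x y d e} → x ≡ y + d → q * q * y ≡ x + e →
  (x + q * y) * (x + q * y) + d * e ≡ suc q * suc q * (x * y)
deficit q {x} {y} {d} {e} refl q²y≡x+e = begin
  (x + q * y) * (x + q * y) + d * e       ≡⟨ expand q x y (d * e) ⟩
  x * x + c + q * q * y * y + d * e       ≡⟨ cong (λ z → x * x + c + z * y + d * e) q²y≡x+e ⟩
  x * x + c + (x + e) * y + d * e         ≡⟨ exchange y d e c ⟩
  x * (x + e) + c + x * y                 ≡⟨ cong (λ z → x * z + c + x * y) q²y≡x+e ⟨
  x * (q * q * y) + c + x * y             ≡⟨ collect q x y ⟩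
  suc q * suc q * (x * y)                 ∎
  where
  open ≡-Reasoning
  c = 2 * (q * (x * y))
  expand : ∀ q x y u → (x + q * y) * (x + q * y) + u ≡ x * x + 2 * (q * (x * y)) + q * q * y * y + u
  expand = solve-∀
  exchange : ∀ y d e c → (y + d) * (y + d) + c + (y + d + e) * y + d * e ≡ (y + d) * (y + d + e) + c + (y + d) * y
  exchange = solve-∀
  collect : ∀ q x y → x * (q * q * y) + 2 * (q * (x * y)) + x * y ≡ suc q * suc q * (x * y)
  collect = solve-∀

-- The two largest values are taken with multiplicity, so `Y` may equal `X`; `second` indexes the
-- values that remain after `top` is removed.
module LargestTwo {r} (f : Fin (2 + r) → ℕ) where
  q : ℕ
  q = suc r

  top : Fin (suc q)
  top = proj₁ (argmax f)

  second : Fin q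
  second = proj₁ (argmax (f ∘ punchIn top))

  X Y : ℕ
  X = f top
  Y = f (punchIn top second)

  f≤X : ∀ j → f j ≤ X
  f≤X = proj₂ (argmax f)

  Y≤X : Y ≤ X
  Y≤X = f≤X (punchIn top second)

  punched≤Y : ∀ j → f (punchIn top j) ≤ Y
  punched≤Y = proj₂ (argmax (f ∘ punchIn top))

  f≤Y : ∀ j → j ≢ top → f j ≤ Y
  f≤Y = punchIn-≢ top punched≤Y

  sum-f≤ : sum f ≤ X + q * Y
  sum-f≤ = ≤-trans (≤-reflexive (sum-remove f)) (+-monoʳ-≤ X (sum-≤ punched≤Y))

  module CrossProducts (g : Fin (suc q) → ℕ) {K} (cross : ∀ i j → i ≢ j → f i * g j ≤ K) where
    open ≤-Reasoning

    -- Pairing `g top` with `Y` bounds it by K/Y, and pairing every other value with `X` bounds it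
    -- by K/X; the factor `X * Y` clears the denominators.
    sum-g≤ : X * Y * sum g ≤ K * (X + q * Y)
    sum-g≤ = begin
      X * Y * sum g            ≡⟨ cong (X * Y *_) (sum-remove g) ⟩
      X * Y * (g top + Σrest)  ≡⟨ split X Y (g top) Σrest ⟩
      X * (Y * g top) + Y * (X * Σrest)
        ≡⟨ cong (λ z → X * (Y * g top) + Y * z) (*-distribˡ-sum X (g ∘ punchIn top)) ⟩
      X * (Y * g top) + Y * sum (λ j → X * g (punchIn top j))
        ≤⟨ +-mono-≤ (*-monoʳ-≤ X (cross _ _ (punchInᵢ≢i top second)))
                    (*-monoʳ-≤ Y (sum-≤ λ j → cross _ _ (punchInᵢ≢i top j ∘ sym))) ⟩
      X * K + Y * (q * K)      ≡⟨ merge X Y K q ⟩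
      K * (X + q * Y)          ∎
      where
      Σrest = sum (g ∘ punchIn top)
      split : ∀ x y a b → x * y * (a + b) ≡ x * (y * a) + y * (x * b)
      split = solve-∀
      merge : ∀ x y k q → x * k + y * (q * k) ≡ k * (x + q * y)
      merge = solve-∀

    sum-product≤ : X * Y * (sum f * sum g) ≤ K * ((X + q * Y) * (X + q * Y))
    sum-product≤ = begin
      X * Y * (sum f * sum g)              ≡⟨ rearr X Y (sum f) (sum g) ⟩
      sum f * (X * Y * sum g)              ≤⟨ *-mono-≤ sum-f≤ sum-g≤ ⟩
      (X + q * Y) * (K * (X + q * Y))      ≡⟨ rearr′ (X + q * Y) K ⟩
      K * ((X + q * Y) * (X + q * Y))      ∎
      where
      rearr : ∀ x y a b → x * y * (a * b) ≡ a * (x * y * b)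
      rearr = solve-∀
      rearr′ : ∀ z k → z * (k * z) ≡ k * (z * z)
      rearr′ = solve-∀

  module Deficit (X≤q²Y : X ≤ q * q * Y) where
    d e : ℕ
    d = X ∸ Y
    e = q * q * Y ∸ X

    X≡Y+d : X ≡ Y + d
    X≡Y+d = sym (m+[n∸m]≡n Y≤X)

    q²Y≡X+e : q * q * Y ≡ X + e
    q²Y≡X+e = sym (m+[n∸m]≡n X≤q²Y)

    -- Since `d * e` is at least 0, (X + q Y)² ≤ (q + 1)² X Y, and equality needs `d` or `e` to
    -- vanish.
    square-deficit : (X + q * Y) * (X + q * Y) + d * e ≡ suc q * suc q * (X * Y)
    square-deficit = deficit q X≡Y+d q²Y≡X+e

-- The inductive step for the odds inequality.

-- `2 + r` is the size of the first coordinate, `N` the number of vectors in the remaining ones, and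
-- `a`, `b` list the slice sizes of the two families.
module Slices (t {r N} : ℕ) (t≤r : t ≤ r) (0<N : 0 < N) (a b : Fin (2 + r) → ℕ)
  (a≤N : ∀ i → a i ≤ N) (bounded : ∀ i j → i ≢ j → Bounded (weight t) N (a i) (b j)) where

  w p K : ℕ
  w = weight t
  p = 2 + r
  K = suc w * (N * N)

  instance
    N≢0 : NonZero N
    N≢0 = >-nonZero 0<N

  α β : Fin p → ℕ
  α i = N + w * a i
  β j = N + w * b j

  cross : ∀ i j → i ≢ j → α i * β j ≤ K
  cross i j i≢j = factor {w} {N} {a i} {b j} (bounded i j i≢j)

  open LargestTwo α public
  open CrossProducts β cross public

  N≤Y : N ≤ Y
  N≤Y = m≤m+n N _

  instance
    Y≢0 : NonZero Y
    Y≢0 = >-nonZero (≤-trans 0<N N≤Y)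
    X≢0 : NonZero X
    X≢0 = >-nonZero (≤-trans (>-nonZero⁻¹ Y) Y≤X)
    XY≢0 : NonZero (X * Y)
    XY≢0 = m*n≢0 X Y

  X≤m²N : X ≤ suc t * suc t * N
  X≤m²N = ≤-trans (+-monoʳ-≤ N (*-monoʳ-≤ w (a≤N top))) (≤-reflexive (cong (_* N) (suc-weight t)))

  -- Every α lies between N and (k - 1)² N, and k - 1 ≤ q.
  X≤q²Y : X ≤ q * q * Y
  X≤q²Y = ≤-trans X≤m²N (*-mono-≤ (*-mono-≤ (s≤s t≤r) (s≤s t≤r)) N≤Y)

  open Deficit X≤q²Y public

  -- By `sum-affine` this is the factored odds inequality for the total sizes, with `p * N` in place
  -- of `N`.
  sum-αβ≤ : sum α * sum β ≤ suc w * (p * N * (p * N))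
  sum-αβ≤ = *-cancelˡ-≤ (X * Y) (begin
    X * Y * (sum α * sum β)                    ≤⟨ sum-product≤ ⟩
    K * ((X + q * Y) * (X + q * Y))            ≤⟨ *-monoʳ-≤ K (m+n≤o⇒m≤o _ (≤-reflexive square-deficit)) ⟩
    K * (p * p * (X * Y))                      ≡⟨ rearr (suc w) N p (X * Y) ⟩
    X * Y * (suc w * (p * N * (p * N)))        ∎)
    where
    open ≤-Reasoning
    rearr : ∀ v N p z → v * (N * N) * (p * p * z) ≡ z * (v * (p * N * (p * N)))
    rearr = solve-∀

-- For k = 2 the weight w vanishes, so α = β = N carry no information and the sums are bounded directly.
sum-bounded-2 : ∀ {r N} → 0 < N → (a b : Fin (2 + r) → ℕ) →
  (∀ i j → i ≢ j → Bounded 0 N (a i) (b j)) → Bounded 0 ((2 + r) * N) (sum a) (sum b)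
-- Adding Y + q X avoids subtraction: its terms pair with those of Σb through a_i + b_j ≤ N, and it
-- dominates the bound X + q Y on Σa because Y ≤ X.
sum-bounded-2 {r} {N} 0<N a b bounded = *-monoʳ-≤ ((2 + r) * N) (+-cancelʳ-≤ (Y + q * X) _ _ (begin
  sum a + sum b + (Y + q * X)
    ≤⟨ +-monoˡ-≤ (Y + q * X) (+-monoˡ-≤ (sum b) sum-f≤) ⟩
  X + q * Y + sum b + (Y + q * X)
    ≡⟨ cong (λ z → X + q * Y + z + (Y + q * X)) (sum-remove b) ⟩
  X + q * Y + (b top + Σrest) + (Y + q * X)
    ≡⟨ rearr X Y r (b top) Σrest ⟩
  (Y + b top) + (q * X + Σrest) + (X + Y + r * Y)
    ≡⟨ cong (λ z → (Y + b top) + z + (X + Y + r * Y))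
         (sym (trans (sum-affine (b ∘ punchIn top) X 1) (cong (q * X +_) (*-identityˡ Σrest)))) ⟩
  (Y + b top) + sum (λ j → X + 1 * b (punchIn top j)) + (X + Y + r * Y)
    ≤⟨ +-mono-≤ (+-mono-≤ (pair _ _ (punchInᵢ≢i top second)) (sum-≤ λ j →
         ≤-trans (≤-reflexive (cong (X +_) (*-identityˡ _))) (pair _ _ (punchInᵢ≢i top j ∘ sym))))
       (+-monoʳ-≤ (X + Y) (*-monoʳ-≤ r Y≤X)) ⟩
  N + q * N + (X + Y + r * X)
    ≡⟨ rearr′ X Y r N ⟩
  (2 + r) * N + (Y + q * X) ∎))
  where
  open ≤-Reasoning
  open LargestTwo a
  Σrest = sum (b ∘ punchIn top)
  pair : ∀ i j → i ≢ j → a i + b j ≤ N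
  pair i j i≢j = *-cancelˡ-≤ N {{>-nonZero 0<N}} (bounded i j i≢j)
  rearr : ∀ x y r b s → x + (1 + r) * y + (b + s) + (y + (1 + r) * x) ≡ (y + b) + ((1 + r) * x + s) + (x + y + r * y)
  rearr = solve-∀
  rearr′ : ∀ x y r N → N + (1 + r) * N + (x + y + r * x) ≡ (2 + r) * N + (y + (1 + r) * x)
  rearr′ = solve-∀

sum-bounded : ∀ t {r N} → t ≤ r → 0 < N → (a b : Fin (2 + r) → ℕ) → (∀ i → a i ≤ N) →
  (∀ i j → i ≢ j → Bounded (weight t) N (a i) (b j)) →
  Bounded (weight t) ((2 + r) * N) (sum a) (sum b)
sum-bounded zero    t≤r 0<N a b a≤N bounded = sum-bounded-2 0<N a b bounded
sum-bounded (suc t) {r} {N} t≤r 0<N a b a≤N bounded = unfactor {weight (suc t)} {(2 + r) * N} {sum a} {sum b}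
  (subst₂ (λ x y → x * y ≤ suc w * (p * N * (p * N))) (sum-affine a N w) (sum-affine b N w) sum-αβ≤)
  where open Slices (suc t) t≤r 0<N a b a≤N bounded

-- From the odds inequality to exact densities.

-- Writing x = N - d, the bound on the sum gives y ≤ N + d, hence x y ≤ N² - d², so that d = 0.
sum-product-tight-≤ : ∀ {N x y} → 0 < N → x ≤ N → x + y ≤ N + N → N * N ≤ x * y → x ≡ N × y ≡ N
sum-product-tight-≤ {N} {x} {y} 0<N x≤N x+y≤ N²≤ = x≡N , ≤-antisym
  (+-cancelˡ-≤ N y N (subst (λ z → z + y ≤ N + N) x≡N x+y≤))
  (*-cancelˡ-≤ N {{>-nonZero 0<N}} (subst (λ z → N * N ≤ z * y) x≡N N²≤))
  where
  open ≤-Reasoning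
  d = N ∸ x
  N≡x+d : N ≡ x + d
  N≡x+d = sym (m+[n∸m]≡n x≤N)
  square : ∀ x d → (x + d) * (x + d) ≡ x * (x + (d + d)) + d * d
  square = solve-∀
  double : ∀ x d → (x + d) + (x + d) ≡ x + (x + (d + d))
  double = solve-∀
  y≤ : y ≤ x + (d + d)
  y≤ = +-cancelˡ-≤ x y _ (≤-trans x+y≤ (≤-reflexive (trans (cong₂ _+_ N≡x+d N≡x+d) (double x d))))
  d²≡0 : d * d ≡ 0
  d²≡0 = n≤0⇒n≡0 (+-cancelˡ-≤ (x * (x + (d + d))) _ _ (begin
    x * (x + (d + d)) + d * d  ≡⟨ square x d ⟨
    (x + d) * (x + d)          ≡⟨ cong₂ _*_ N≡x+d N≡x+d ⟨
    N * N                      ≤⟨ N²≤ ⟩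
    x * y                      ≤⟨ *-monoʳ-≤ x y≤ ⟩
    x * (x + (d + d))          ≡⟨ +-identityʳ _ ⟨
    x * (x + (d + d)) + 0      ∎))
  d≡0 : d ≡ 0
  d≡0 = reduce (m*n≡0⇒m≡0∨n≡0 d d²≡0)
  x≡N : x ≡ N
  x≡N = trans (sym (+-identityʳ x)) (trans (cong (x +_) (sym d≡0)) (sym N≡x+d))

sum-product-tight : ∀ {N x y} → 0 < N → x + y ≤ N + N → N * N ≤ x * y → x ≡ N × y ≡ N
sum-product-tight {N} {x} {y} 0<N x+y≤ N²≤ with ≤-total x N
... | inj₁ x≤N = sum-product-tight-≤ 0<N x≤N x+y≤ N²≤
... | inj₂ N≤x = swap (sum-product-tight-≤ 0<N y≤N
  (subst (_≤ N + N) (+-comm x y) x+y≤) (subst (N * N ≤_) (*-comm x y) N²≤))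
  where
  y≤N : y ≤ N
  y≤N = +-cancelˡ-≤ N y N (≤-trans (+-monoˡ-≤ y N≤x) x+y≤)

-- Scaling the odds inequality by k² = w + 2k and inserting N² ≤ (k a)(k b) leaves k a + k b ≤ 2N,
-- which meets the arithmetic-geometric mean inequality from the other side.
bounded-tight : ∀ t {N a b} → 0 < N → Bounded (weight t) N a b →
  N * N ≤ (2 + t) * a * ((2 + t) * b) → (2 + t) * a ≡ N × (2 + t) * b ≡ N
bounded-tight t {N} {a} {b} 0<N bounded N²≤ = sum-product-tight 0<N
  (*-cancelˡ-≤ (N * k) {{m*n≢0 N k {{>-nonZero 0<N}}}} (+-cancelˡ-≤ (w * (N * N)) _ _ (begin
    w * (N * N) + N * k * (k * a + k * b)              ≤⟨ +-monoˡ-≤ _ (*-monoʳ-≤ w N²≤) ⟩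
    w * (k * a * (k * b)) + N * k * (k * a + k * b)    ≡⟨ rearr w N k a b ⟩
    k * k * (w * (a * b) + N * (a + b))                ≤⟨ *-monoʳ-≤ (k * k) bounded ⟩
    k * k * (N * N)                                    ≡⟨ square t N ⟩
    w * (N * N) + N * k * (N + N)                      ∎))) N²≤
  where
  open ≤-Reasoning
  k = 2 + t
  w = weight t
  rearr : ∀ w N k a b → w * (k * a * (k * b)) + N * k * (k * a + k * b) ≡ k * k * (w * (a * b) + N * (a + b))
  rearr = solve-∀
  square : ∀ t N → (2 + t) * (2 + t) * (N * N) ≡ t * (2 + t) * (N * N) + N * (2 + t) * (N + N)
  square = solve-∀

-- Equality in the inductive step.

-- `concentrated` is the pattern of a star in the first coordinate, `balanced` that of a star in a
-- later one.
data TightSlices (k N : ℕ) {p} (a b : Fin p → ℕ) : Set where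
  balanced     : (∀ i → k * a i ≡ N) → (∀ j → k * b j ≡ N) → TightSlices k N a b
  concentrated : p ≡ k → (i : Fin p) → a i ≡ N → b i ≡ N →
                 (∀ j → j ≢ i → a j ≡ 0) → (∀ j → j ≢ i → b j ≡ 0) → TightSlices k N a b

-- Here k = 3 + t′, so the weight is positive and α, β determine a, b.
module TightSlicesProof (t′ : ℕ) {r N} (t≤r : suc t′ ≤ r) (0<N : 0 < N) (a b : Fin (2 + r) → ℕ)
  (a≤N : ∀ i → a i ≤ N) (bounded : ∀ i j → i ≢ j → Bounded (weight (suc t′)) N (a i) (b j))
  (Σa-tight : (3 + t′) * sum a ≡ (2 + r) * N) (Σb-tight : (3 + t′) * sum b ≡ (2 + r) * N) where

  open Slices (suc t′) t≤r 0<N a b a≤N bounded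
  open ≤-Reasoning

  t m k : ℕ
  t = suc t′
  m = suc t
  k = 2 + t

  -- Density 1/k is shifted to 1 + w/k = 1 + t = m, as w = t k.
  shifted-tight : ∀ s → k * s ≡ p * N → p * N + w * s ≡ p * (N * m)
  shifted-tight s tight = *-cancelˡ-≡ _ _ k (begin-equality
    k * (p * N + w * s)        ≡⟨ expand k (p * N) t s ⟩
    k * (p * N) + t * k * (k * s)  ≡⟨ cong (λ z → k * (p * N) + t * k * z) tight ⟩
    k * (p * N) + t * k * (p * N)  ≡⟨ collect k p N t ⟩
    k * (p * (N * m))          ∎)
    where
    expand : ∀ k z t s → k * (z + t * k * s) ≡ k * z + t * k * (k * s)
    expand = solve-∀
    collect : ∀ k p N t → k * (p * N) + t * k * (p * N) ≡ k * (p * (N * suc t))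
    collect = solve-∀

  Σα≡ : sum α ≡ p * (N * m)
  Σα≡ = trans (sum-affine a N w) (shifted-tight (sum a) Σa-tight)

  Σβ≡ : sum β ≡ p * (N * m)
  Σβ≡ = trans (sum-affine b N w) (shifted-tight (sum b) Σb-tight)

  K≡ : K ≡ N * m * (N * m)
  K≡ = trans (cong (_* (N * N)) (suc-weight t)) (rearr m N)
    where
    rearr : ∀ m N → m * m * (N * N) ≡ N * m * (N * m)
    rearr = solve-∀

  instance
    Nm≢0 : NonZero (N * m)
    Nm≢0 = m*n≢0 N m
    K≢0 : NonZero K
    K≢0 = m*n≢0 (suc w) (N * N) {{_}} {{m*n≢0 N N}}

  -- By `K≡` the totals of α and β multiply to K p², so `sum-product≤` gives p² X Y ≤ (X + q Y)²,
  -- the reverse of the inequality in `square-deficit`.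
  no-deficit : d * e ≡ 0
  no-deficit = n≤0⇒n≡0 (+-cancelˡ-≤ ((X + q * Y) * (X + q * Y)) _ _ (begin
    (X + q * Y) * (X + q * Y) + d * e  ≡⟨ square-deficit ⟩
    p * p * (X * Y)                    ≤⟨ *-cancelˡ-≤ K cancelled ⟩
    (X + q * Y) * (X + q * Y)          ≡⟨ +-identityʳ _ ⟨
    (X + q * Y) * (X + q * Y) + 0      ∎))
    where
    rearr : ∀ p z u → z * z * (p * p * u) ≡ u * (p * z * (p * z))
    rearr = solve-∀
    cancelled : K * (p * p * (X * Y)) ≤ K * ((X + q * Y) * (X + q * Y))
    cancelled = begin
      K * (p * p * (X * Y))                    ≡⟨ cong (_* (p * p * (X * Y))) K≡ ⟩
      N * m * (N * m) * (p * p * (X * Y))      ≡⟨ rearr p (N * m) (X * Y) ⟩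
      X * Y * (p * (N * m) * (p * (N * m)))    ≡⟨ cong₂ (λ x y → X * Y * (x * y)) Σα≡ Σβ≡ ⟨
      X * Y * (sum α * sum β)                  ≤⟨ sum-product≤ ⟩
      K * ((X + q * Y) * (X + q * Y))          ∎

  unshift : ∀ {s} → N + w * s ≡ N * m → k * s ≡ N
  unshift {s} eq = *-cancelˡ-≡ _ _ t (+-cancelˡ-≡ N _ _ (trans (assoc N t s) (trans eq (collect N t))))
    where
    assoc : ∀ N t s → N + t * ((2 + t) * s) ≡ N + t * (2 + t) * s
    assoc = solve-∀
    collect : ∀ N t → N * suc t ≡ N + t * N
    collect = solve-∀

  vanish : ∀ {s} → N + w * s ≤ N → s ≡ 0
  vanish {s} le = m*n≡0⇒m≡0 s w (trans (*-comm s w)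
    (n≤0⇒n≡0 (+-cancelˡ-≤ N _ _ (≤-trans le (≤-reflexive (sym (+-identityʳ N)))))))

  β≤K/X : ∀ {z} → K ≡ X * z → ∀ j → j ≢ top → β j ≤ z
  β≤K/X K≡Xz j j≢top = *-cancelˡ-≤ X (≤-trans (cross top j (j≢top ∘ sym)) (≤-reflexive K≡Xz))

  -- The average N m of the α is at most X, while with X = Y `sum-g≤` gives X ≤ N m. Then no α or β
  -- exceeds the common average N m, so all of them equal it.
  case-balanced : d ≡ 0 → TightSlices k N a b
  case-balanced d≡0 = balanced
    (λ i → unshift {a i} (sum-≤-tight α≤ Σα≡ i)) (λ j → unshift {b j} (sum-≤-tight β≤ Σβ≡ j))
    where
    X≡Y : X ≡ Y
    X≡Y = trans X≡Y+d (trans (cong (Y +_) d≡0) (+-identityʳ Y))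
    Nm≤X : N * m ≤ X
    Nm≤X = *-cancelˡ-≤ p (begin
      p * (N * m)  ≡⟨ Σα≡ ⟨
      sum α        ≤⟨ sum-≤ f≤X ⟩
      p * X        ∎)
    X≤Nm : X ≤ N * m
    X≤Nm = *-cancelʳ-≤ X (N * m) (p * X * (N * m)) {{m*n≢0 (p * X) (N * m) {{m*n≢0 p X}}}} (begin
      X * (p * X * (N * m))        ≡⟨ rearr X p (N * m) ⟩
      X * X * (p * (N * m))        ≡⟨ cong₂ (λ x y → X * x * y) X≡Y (sym Σβ≡) ⟩
      X * Y * sum β                ≤⟨ sum-g≤ ⟩
      K * (X + q * Y)              ≡⟨ cong₂ (λ x y → x * (X + q * y)) K≡ (sym X≡Y) ⟩
      N * m * (N * m) * (X + q * X)  ≡⟨ rearr′ (N * m) X q ⟩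
      N * m * (p * X * (N * m))    ∎)
      where
      rearr : ∀ x p z → x * (p * x * z) ≡ x * x * (p * z)
      rearr = solve-∀
      rearr′ : ∀ z x q → z * z * (x + q * x) ≡ z * (suc q * x * z)
      rearr′ = solve-∀
    X≡Nm : X ≡ N * m
    X≡Nm = ≤-antisym X≤Nm Nm≤X
    α≤ : ∀ i → α i ≤ N * m
    α≤ i = ≤-trans (f≤X i) X≤Nm
    K≡XNm : K ≡ X * (N * m)
    K≡XNm = trans K≡ (cong (_* (N * m)) (sym X≡Nm))
    β≤ : ∀ j → β j ≤ N * m
    β≤ j with j ≟ top
    ... | no j≢top = β≤K/X K≡XNm j j≢top
    -- `top` cannot be paired with itself; the second index replaces it, as its α is also X.
    ... | yes refl = *-cancelˡ-≤ Y (≤-trans (cross _ top (punchInᵢ≢i top second))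
                       (≤-reflexive (trans K≡XNm (cong (_* (N * m)) X≡Y))))

  -- The chain q² N ≤ q² Y = X ≤ m² N with m ≤ q collapses to q = m and Y = N. Off `top` this leaves
  -- α and β at their least value N, so a and b vanish there.
  case-concentrated : e ≡ 0 → TightSlices k N a b
  case-concentrated e≡0 = concentrated p≡k top
    (*-cancelˡ-≡ _ _ k (total a Σa-tight a-rest)) (*-cancelˡ-≡ _ _ k (total b Σb-tight b-rest)) a-rest b-rest
    where
    q²Y≡X : q * q * Y ≡ X
    q²Y≡X = trans q²Y≡X+e (trans (cong (X +_) e≡0) (+-identityʳ X))
    q≤m : q ≤ m
    q≤m with q ≤? m
    ... | yes q≤m = q≤m
    ... | no q≰m = contradiction (begin-strict
      m * m * N  <⟨ *-monoˡ-< N (*-mono-< (≰⇒> q≰m) (≰⇒> q≰m)) ⟩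
      q * q * N  ≤⟨ *-monoʳ-≤ (q * q) N≤Y ⟩
      q * q * Y  ≡⟨ q²Y≡X ⟩
      X          ≤⟨ X≤m²N ⟩
      m * m * N  ∎) (<-irrefl refl)
    q≡m : q ≡ m
    q≡m = ≤-antisym q≤m (s≤s t≤r)
    p≡k : p ≡ k
    p≡k = cong suc q≡m
    X≡m²Y : X ≡ m * m * Y
    X≡m²Y = trans (sym q²Y≡X) (cong (λ z → z * z * Y) q≡m)
    Y≤N : Y ≤ N
    Y≤N = *-cancelˡ-≤ (m * m) (≤-trans (≤-reflexive (sym X≡m²Y)) X≤m²N)
    K≡XN : K ≡ X * N
    K≡XN = trans (cong (_* (N * N)) (suc-weight t)) (trans (sym (*-assoc (m * m) N N))
      (cong (_* N) (trans (cong (m * m *_) (≤-antisym N≤Y Y≤N)) (sym X≡m²Y))))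
    a-rest : ∀ j → j ≢ top → a j ≡ 0
    a-rest j j≢top = vanish (≤-trans (f≤Y j j≢top) Y≤N)
    b-rest : ∀ j → j ≢ top → b j ≡ 0
    b-rest j j≢top = vanish (β≤K/X K≡XN j j≢top)
    total : ∀ f → k * sum f ≡ p * N → (∀ j → j ≢ top → f j ≡ 0) → k * f top ≡ k * N
    total f tight rest = trans (cong (k *_) (sym (sum-concentrated f top rest))) (trans tight (cong (_* N) p≡k))

  tight-slices : TightSlices k N a b
  tight-slices = [ case-balanced , case-concentrated ]′ (m*n≡0⇒m≡0∨n≡0 d no-deficit)

-- Counting families by slices.

length-filter-map : ∀ {X Y : Set} (P : Y → Bool) (f : X → Y) xs →
  length (filter (T? ∘ P) (map f xs)) ≡ length (filter (T? ∘ P ∘ f) xs)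
length-filter-map P f []       = refl
length-filter-map P f (x ∷ xs) with P (f x)
... | true  = cong suc (length-filter-map P f xs)
... | false = length-filter-map P f xs

-- An arbitrary tabulated list replaces `allFin` so that the induction can pass to `xs ∘ suc`.
length-filter-product : ∀ {X Y Z : Set} {n} (P : Z → Bool) (_•_ : X → Y → Z) (xs : Fin n → X) ys →
  length (filter (T? ∘ P) (cartesianProductWith _•_ (tabulate xs) ys)) ≡
  sum (λ i → length (filter (λ y → T? (P (xs i • y))) ys))
length-filter-product {n = zero}  P _•_ xs ys = refl
length-filter-product {n = suc n} P _•_ xs ys = begin
  length (filter (T? ∘ P) (row List.++ rows))
    ≡⟨ cong length (filter-++ (T? ∘ P) row rows) ⟩
  length (filter (T? ∘ P) row List.++ filter (T? ∘ P) rows)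
    ≡⟨ length-++ (filter (T? ∘ P) row) ⟩
  length (filter (T? ∘ P) row) + length (filter (T? ∘ P) rows)
    ≡⟨ cong₂ _+_ (length-filter-map P (xs zero •_) ys) (length-filter-product P _•_ (xs ∘ suc) ys) ⟩
  sum (λ i → length (filter (λ y → T? (P (xs i • y))) ys)) ∎
  where
  open ≡-Reasoning
  row = map (xs zero •_) ys
  rows = cartesianProductWith _•_ (tabulate (xs ∘ suc)) ys

private
  variable
    n : ℕ
    p : Vec ℕ n

slice : ∀ {m} → Family (m ∷ p) → Fin m → Family p
slice A i x = A (i ∷ x)

card-slices : ∀ {m} (A : Family (m ∷ p)) → card A ≡ sum (card ∘ slice A)
card-slices {p = p} A = length-filter-product A _∷_ id (vectors p)

card-full-∷ : ∀ m (p : Vec ℕ n) → card (full (m ∷ p)) ≡ m * card (full p)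
card-full-∷ m p = trans (card-slices (full (m ∷ p))) (sum-const m _)

card-full : (p : Vec ℕ n) → card (full p) ≡ length (vectors p)
card-full p = cong length (filter-all (λ x → T? (full p x)) (ListAll.universal (λ _ → tt) (vectors p)))

card-full>0 : ∀ {k} → 0 < k → {p : Vec ℕ n} → All (k ≤_) p → 0 < card (full p)
card-full>0 0<k {[]}    []          = s≤s z≤n
card-full>0 0<k {m ∷ p} (k≤m ∷ k≤p) = subst (0 <_) (sym (card-full-∷ m p))
  (*-mono-≤ (≤-trans 0<k k≤m) (card-full>0 0<k k≤p))

card≤full : (A : Family p) → card A ≤ card (full p)
card≤full {p = p} A = ≤-trans (length-filter (λ x → T? (A x)) (vectors p)) (≤-reflexive (sym (card-full p)))

card≡0⇒empty : (A : Family p) → card A ≡ 0 → ∀ x → A x ≡ false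
card≡0⇒empty A card≡0 x with A x in Ax
... | false = refl
... | true  = contradiction (sym card≡0)
  (<⇒≢ (filter-some (λ x → T? (A x)) (lose (vectors-complete x) (subst T (sym Ax) tt))))

card≡full⇒full : (A : Family p) → card A ≡ card (full p) → ∀ x → A x ≡ true
card≡full⇒full {p = p} A card≡ x with A x in Ax
... | true  = refl
... | false = contradiction (trans card≡ (card-full p))
  (<⇒≢ (filter-notAll (λ x → T? (A x)) (vectors p) (lose (vectors-complete x) (subst T Ax))))

-- Cross-intersection of slices, and stars.

-- Distinct first coordinates contribute nothing to the agreement set, so an agreement must occur
-- among the remaining ones.
slices-cross : ∀ {m} {A B : Family (m ∷ p)} → CrossIntersecting 1 A B →
  ∀ i j → i ≢ j → CrossIntersecting 1 (slice A i) (slice B j)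
slices-cross cross i j i≢j x y Ax By =
  subst (λ b → 1 ≤ ∣ b Vec.∷ agreement x y ∣) (dec-false (i ≟ j) i≢j) (cross (i ∷ x) (j ∷ y) Ax By)

intersecting-at : (x y : S p) (i : Fin n) → x at i ≡ y at i → Intersecting 1 x y
intersecting-at (a ∷ x) (b ∷ y) zero eq rewrite dec-true (a ≟ b) eq = s≤s z≤n
intersecting-at (a ∷ x) (b ∷ y) (suc i) eq with does (a ≟ b)
... | true  = s≤s z≤n
... | false = intersecting-at x y i eq

star-coordinate : (i : Fin n) (j : Fin (lookup p i)) (x : S p) → T (star p i j x) → x at i ≡ j
star-coordinate i j x Tx with x at i ≟ j
... | yes eq = eq

star-cross : (i : Fin n) (j : Fin (lookup p i)) → CrossIntersecting 1 (star p i j) (star p i j)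
star-cross i j x y Tx Ty =
  intersecting-at x y i (trans (star-coordinate i j x Tx) (sym (star-coordinate i j y Ty)))

card-star : (p : Vec ℕ n) (i : Fin n) (j : Fin (lookup p i)) → card (star p i j) * lookup p i ≡ card (full p)
card-star (zero ∷ p) zero ()
card-star (suc m ∷ p) zero j = begin
  card (star (suc m ∷ p) zero j) * suc m  ≡⟨ cong (_* suc m) (card-slices (star (suc m ∷ p) zero j)) ⟩
  sum (λ a → const-card (does (a ≟ j))) * suc m
    ≡⟨ cong (_* suc m) (sum-concentrated _ j
         λ a a≢j → trans (cong const-card (dec-false (a ≟ j) a≢j)) card-empty) ⟩
  const-card (does (j ≟ j)) * suc m       ≡⟨ cong (λ b → const-card b * suc m) (dec-true (j ≟ j) refl) ⟩
  card (full p) * suc m                   ≡⟨ *-comm (card (full p)) (suc m) ⟩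
  suc m * card (full p)                   ≡⟨ card-full-∷ (suc m) p ⟨
  card (full (suc m ∷ p))                 ∎
  where
  open ≡-Reasoning
  const-card : Bool → ℕ
  const-card b = card {p = p} (λ _ → b)
  card-empty : const-card false ≡ 0
  card-empty = cong length (filter-none (λ x → T? false) (ListAll.universal (λ _ ()) (vectors p)))
card-star (m ∷ p) (suc i) j = begin
  card (star (m ∷ p) (suc i) j) * lookup p i
    ≡⟨ cong (_* lookup p i) (trans (card-slices (star (m ∷ p) (suc i) j)) (sum-const m _)) ⟩
  m * card (star p i j) * lookup p i          ≡⟨ *-assoc m _ _ ⟩
  m * (card (star p i j) * lookup p i)        ≡⟨ cong (m *_) (card-star p i j) ⟩
  m * card (full p)                           ≡⟨ card-full-∷ m p ⟨
  card (full (m ∷ p))                         ∎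
  where open ≡-Reasoning

-- The minimum as an attained lower bound.

minimum-≤ : (p : Vec ℕ (suc n)) → All (minimum p ≤_) p
minimum-≤ (m ∷ [])     = ≤-refl ∷ []
minimum-≤ (m ∷ l ∷ p)  = m⊓n≤m m _ ∷ All.map (≤-trans (m⊓n≤n m _)) (minimum-≤ (l ∷ p))

minimum-attained : (p : Vec ℕ (suc n)) → Σ[ i ∈ Fin (suc n) ] lookup p i ≡ minimum p
minimum-attained (m ∷ [])    = zero , refl
minimum-attained (m ∷ l ∷ p) with ⊓-sel m (minimum (l ∷ p)) | minimum-attained (l ∷ p)
... | inj₁ eq | _       = zero , sym eq
... | inj₂ eq | i , eq′ = suc i , trans eq′ (sym eq)

-- Induction on the coordinates.

-- `2 + t` is any common lower bound of the entries, since the minimum may grow when a coordinate is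
-- removed.
card-bounded : ∀ t {p : Vec ℕ n} → All (2 + t ≤_) p → (A B : Family p) → CrossIntersecting 1 A B →
  Bounded (weight t) (card (full p)) (card A) (card B)
card-bounded t {[]} [] A B cross with A [] in A[] | B [] in B[]
-- The empty vector agrees with itself nowhere, so A and B cannot both contain it.
... | true  | true  = contradiction (cross [] [] (subst T (sym A[]) tt) (subst T (sym B[]) tt)) λ ()
... | true  | false rewrite *-zeroʳ (weight t) = ≤-refl
... | false | true  rewrite *-zeroʳ (weight t) = ≤-refl
... | false | false rewrite *-zeroʳ (weight t) = z≤n
card-bounded t {suc (suc r) ∷ p} (s≤s (s≤s t≤r) ∷ k≤p) A B cross =
  subst₂ (λ N a → Bounded (weight t) N a (card B)) (sym (card-full-∷ (2 + r) p)) (sym (card-slices A))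
    (subst (Bounded (weight t) ((2 + r) * card (full p)) (sum (card ∘ slice A))) (sym (card-slices B))
      (sum-bounded t t≤r (card-full>0 (s≤s z≤n) k≤p) (card ∘ slice A) (card ∘ slice B) (card≤full ∘ slice A)
        λ i j i≢j → card-bounded t k≤p (slice A i) (slice B j) (slices-cross {A = A} {B = B} cross i j i≢j)))

IsStarPair : {p : Vec ℕ n} → ℕ → Family p → Family p → Set
IsStarPair {n} {p} k A B =
  Σ[ i ∈ Fin n ] Σ[ j ∈ Fin (lookup p i) ] (lookup p i ≡ k × A ≗ star p i j × B ≗ star p i j)

-- With at least three slices, A_i and A_0 can be compared through a slice B_l with l different from
-- both i and 0. This fails for k = 2.
avoid-two : ∀ {r} → 1 ≤ r → (i : Fin (2 + r)) → Σ[ l ∈ Fin (2 + r) ] (l ≢ i × l ≢ zero)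
avoid-two (s≤s _) zero          = suc zero , (λ ()) , λ ()
avoid-two (s≤s _) (suc zero)    = suc (suc zero) , (λ ()) , λ ()
avoid-two (s≤s _) (suc (suc i)) = suc zero , (λ ()) , λ ()

tight⇒star : ∀ t {p : Vec ℕ n} → All (3 + t ≤_) p → (A B : Family p) → CrossIntersecting 1 A B →
  (3 + t) * card A ≡ card (full p) → (3 + t) * card B ≡ card (full p) → IsStarPair (3 + t) A B
-- There is a single vector, and 1 is not a multiple of k ≥ 3.
tight⇒star t {[]} [] A B cross A-tight _ = contradiction (m*n≡1⇒m≡1 (3 + t) (card A) A-tight) λ ()
tight⇒star t {suc (suc r) ∷ p} (s≤s (s≤s t<r) ∷ k≤p) A B cross A-tight B-tight =
  from-slices (TightSlicesProof.tight-slices t t<r (card-full>0 (s≤s z≤n) k≤p) (card ∘ slice A) (card ∘ slice B)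
    (card≤full ∘ slice A)
    (λ i j i≢j → card-bounded (suc t) k≤p (slice A i) (slice B j) (slices-cross {A = A} {B = B} cross i j i≢j))
    (sum-tight A A-tight) (sum-tight B B-tight))
  where
  N = card (full p)
  sum-tight : ∀ F → (3 + t) * card F ≡ card (full (2 + r ∷ p)) → (3 + t) * sum (card ∘ slice F) ≡ (2 + r) * N
  sum-tight F tight = trans (cong ((3 + t) *_) (sym (card-slices F))) (trans tight (card-full-∷ (2 + r) p))

  from-slices : TightSlices (3 + t) N (card ∘ slice A) (card ∘ slice B) → IsStarPair (3 + t) A B
  from-slices (concentrated p≡k i A-full B-full A-empty B-empty) =
    zero , i , p≡k , is-star A A-full A-empty , is-star B B-full B-empty
    where
    is-star : ∀ F → card (slice F i) ≡ N → (∀ j → j ≢ i → card (slice F j) ≡ 0) →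
      F ≗ star (2 + r ∷ p) zero i
    is-star F F-full F-empty (a ∷ x) with a ≟ i
    ... | yes refl = card≡full⇒full (slice F i) F-full x
    ... | no a≢i   = card≡0⇒empty (slice F a) (F-empty a a≢i) x
  -- Every off-diagonal pair of slices is again extremal. The pair (0, 1) supplies the star, and the
  -- identities A_i = B_j carry it to all slices.
  from-slices (balanced A-balanced B-balanced) = lift (slices-star zero (suc zero) λ ())
    where
    slices-star : ∀ i j → i ≢ j → IsStarPair (3 + t) (slice A i) (slice B j)
    slices-star i j i≢j = tight⇒star t k≤p (slice A i) (slice B j)
      (slices-cross {A = A} {B = B} cross i j i≢j) (A-balanced i) (B-balanced j)
    A≗B : ∀ i j → i ≢ j → slice A i ≗ slice B j
    A≗B i j i≢j x with slices-star i j i≢j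
    ... | _ , _ , _ , A≗ , B≗ = trans (A≗ x) (sym (B≗ x))
    A≗A₀ : ∀ i → slice A i ≗ slice A zero
    A≗A₀ i x with avoid-two (≤-trans (s≤s z≤n) t<r) i
    ... | l , l≢i , l≢0 = trans (A≗B i l (l≢i ∘ sym) x) (sym (A≗B zero l (l≢0 ∘ sym) x))
    B≗A₀ : ∀ i → slice B i ≗ slice A zero
    B≗A₀ i x with avoid-two (≤-trans (s≤s z≤n) t<r) i
    ... | l , l≢i , l≢0 = trans (sym (A≗B l i l≢i x)) (A≗A₀ l x)
    lift : IsStarPair (3 + t) (slice A zero) (slice B (suc zero)) → IsStarPair (3 + t) A B
    lift (i , j , pᵢ≡k , A₀≗star , _) = suc i , j , pᵢ≡k ,
      (λ { (a ∷ x) → trans (A≗A₀ a x) (A₀≗star x) }) , λ { (a ∷ x) → trans (B≗A₀ a x) (A₀≗star x) }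

-- The product bound and its equality cases.

squares : ∀ a b k → a * b * (k * (k * 1)) ≡ k * a * (k * b)
squares = solve-∀

square-^ : ∀ N → N ^ 2 ≡ N * N
square-^ N = cong (N *_) (*-identityʳ N)

-- Assuming only a lower bound on the product lets this serve both the inequality and its equality
-- case.
card-tight : ∀ t {p : Vec ℕ n} → All (2 + t ≤_) p → (A B : Family p) → CrossIntersecting 1 A B →
  card (full p) ^ 2 ≤ card A * card B * (2 + t) ^ 2 →
  (2 + t) * card A ≡ card (full p) × (2 + t) * card B ≡ card (full p)
card-tight t {p} k≤p A B cross N²≤ = bounded-tight t {card (full p)} {card A} {card B} (card-full>0 (s≤s z≤n) k≤p)
  (card-bounded t k≤p A B cross)
  (subst₂ _≤_ (square-^ (card (full p))) (squares (card A) (card B) (2 + t)) N²≤)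

card-product≤ : ∀ {k} → 0 < k → {p : Vec ℕ n} → All (k ≤_) p →
  (A B : Family p) → CrossIntersecting 1 A B → card A * card B * k ^ 2 ≤ card (full p) ^ 2
card-product≤ {k = suc zero} _ {p} _ A B _ = subst₂ _≤_ (sym (*-identityʳ _)) (sym (square-^ (card (full p))))
  (*-mono-≤ (card≤full A) (card≤full B))
card-product≤ {k = suc (suc t)} _ {p} k≤p A B cross
  with ≤-total (card A * card B * (2 + t) ^ 2) (card (full p) ^ 2)
... | inj₁ ≤N² = ≤N²
-- Both densities are then exactly 1/k, so the product cannot exceed the bound.
... | inj₂ N²≤ = ≤-reflexive (trans (squares (card A) (card B) (2 + t))
  (trans (cong₂ _*_ A-tight B-tight) (sym (square-^ (card (full p))))))
  where
  A-tight = proj₁ (card-tight t k≤p A B cross N²≤)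
  B-tight = proj₂ (card-tight t k≤p A B cross N²≤)

card-star-square : ∀ (p : Vec ℕ n) {k} i → lookup p i ≡ k → ∀ j →
  card (star p i j) * card (star p i j) * k ^ 2 ≡ card (full p) ^ 2
card-star-square p {k} i refl j = begin
  s * s * k ^ 2          ≡⟨ squares s s k ⟩
  k * s * (k * s)        ≡⟨ cong (λ z → z * z) (trans (*-comm k s) (card-star p i j)) ⟩
  card (full p) * card (full p)  ≡⟨ square-^ (card (full p)) ⟨
  card (full p) ^ 2      ∎
  where
  open ≡-Reasoning
  s = card (star p i j)

*-tight : ∀ {N a b} → 0 < N → a ≤ N → b ≤ N → a * b ≡ N * N → a ≡ N
*-tight {N} {a} {b} 0<N a≤N b≤N ab≡ = ≤-antisym a≤N (*-cancelʳ-≤ N a N {{>-nonZero 0<N}} (begin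
  N * N  ≡⟨ ab≡ ⟨
  a * b  ≤⟨ *-monoʳ-≤ a b≤N ⟩
  a * N  ∎))
  where open ≤-Reasoning

subsingleton : ∀ {m} → m ≡ 1 → (i j : Fin m) → i ≡ j
subsingleton refl zero zero = refl

-- For k = 1 equality makes A and B full, and a star in a coordinate with a single value is full as
-- well. For k ≥ 3 equality fixes both densities at 1/k and `tight⇒star` applies.
extremal⇒star : ∀ {k} → 0 < k → k ≢ 2 → {p : Vec ℕ n} → All (k ≤_) p →
  Σ[ i ∈ Fin n ] lookup p i ≡ k → (A B : Family p) → CrossIntersecting 1 A B →
  card A * card B * k ^ 2 ≡ card (full p) ^ 2 → IsStarPair k A B
extremal⇒star {k = suc zero} 0<k _ {p} k≤p (i , pᵢ≡1) A B _ eq =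
  i , j , pᵢ≡1 , is-star A (*-tight N>0 (card≤full A) (card≤full B) ab≡N²) ,
  is-star B (*-tight N>0 (card≤full B) (card≤full A) (trans (*-comm (card B) (card A)) ab≡N²))
  where
  N>0 = card-full>0 0<k k≤p
  ab≡N² : card A * card B ≡ card (full p) * card (full p)
  ab≡N² = trans (sym (*-identityʳ _)) (trans eq (square-^ (card (full p))))
  j : Fin (lookup p i)
  j = subst Fin (sym pᵢ≡1) zero
  is-star : ∀ F → card F ≡ card (full p) → F ≗ star p i j
  is-star F F-full x = trans (card≡full⇒full F F-full x)
    (sym (dec-true (x at i ≟ j) (subsingleton pᵢ≡1 (x at i) j)))
extremal⇒star {k = suc (suc zero)}    _ k≢2 = contradiction refl k≢2
extremal⇒star {k = suc (suc (suc t))} _ _ k≤p _ A B cross eq =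
  tight⇒star t k≤p A B cross (proj₁ tight) (proj₂ tight)
  where tight = card-tight (suc t) k≤p A B cross (≤-reflexive (sym eq))

theorem1 : ∀ {n} (p : Vec ℕ (suc n)) → All (0 <_) p →
    let k = minimum p in
    (∀ (A B : Family p) → CrossIntersecting 1 A B →
    card A * card B * k ^ 2 ≤ card (full p) ^ 2)
    × (∀ (i : Fin (suc n)) → lookup p i ≡ k → ∀ (j : Fin (lookup p i)) →
    CrossIntersecting 1 (star p i j) (star p i j)
    × card (star p i j) * card (star p i j) * k ^ 2 ≡ card (full p) ^ 2)
    × (k ≢ 2 → ∀ (A B : Family p) → CrossIntersecting 1 A B →
    card A * card B * k ^ 2 ≡ card (full p) ^ 2 →
    Σ[ i ∈ Fin (suc n) ] Σ[ j ∈ Fin (lookup p i) ]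
    (lookup p i ≡ k × A ≗ star p i j × B ≗ star p i j))
theorem1 p p>0 =
  card-product≤ 0<k (minimum-≤ p) ,
  (λ i pᵢ≡k j → star-cross i j , card-star-square p i pᵢ≡k j) ,
  λ k≢2 → extremal⇒star 0<k k≢2 (minimum-≤ p) (minimum-attained p)
  where
  0<k : 0 < minimum p
  0<k = subst (0 <_) (proj₂ (minimum-attained p)) (All.lookup p>0 (∈-lookup (proj₁ (minimum-attained p)) p))
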